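{- If $G$ is a $\mathcal{T}_1$-graph, then the $r$-independence complex $\mathrm{Ind}_r(G)$ is shellable for all integers $r \geq 5$.
   Context: All graphs are finite and simple. A block of a graph is a maximal connected subgraph that remains connected after removal of any single vertex; $G$ is a block graph if every block is a complete graph (a clique). An $n$-clique path $\mathrm{CP}(B_1,\dots,B_n)$ ($n\ge 1$) is a graph consisting of cliques $B_1,\dots,B_n$ arranged linearly, where each consecutive pair $B_i, B_{i+1}$ shares exactly one vertex $x_i$; $x_1,\dots,x_{n-1}$ are its connecting vertices. A connected graph $H$ is a $\mathcal{T}_1$-graph if it is a block graph and contains a clique-path subgraph $P = \mathrm{CP}(B_1,\dots,B_n)$, $n \ge 1$, of maximum length, with connecting vertices $x_i \in B_i\cap B_{i+1}$ ($1\le i\le n-1$), such that every clique (block) $K$ of $H$ not belonging to $P$ satisfies $V(K)\cap V(P) = \{x_i\}$ for some $1 \le i \le n-1$. A graph is a $\mathcal{T}_1$-graph if each of its connected components is. For $r \geq 1$, a subset $A \subseteq V(G)$ is $r$-independent if every connected component of $G[A]$ has at most $r$ vertices; $\mathrm{Ind}_r(G)$ is the simplicial complex on $V(G)$ of all $r$-independent subsets. A (not necessarily pure) simplicial complex is shellable if its facets can be ordered $F_1,\dots,F_t$ so that for each $k>1$, $\langle F_k\rangle \cap \langle F_1,\dots,F_{k-1}\rangle$ is pure of dimension $\dim F_k-1$ ($\langle\mathcal F\rangle$ = complex generated by $\mathcal F$). -}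

module Defs where

open import Data.Nat using (ℕ; zero; suc; _<_; _≤_)
open import Data.Fin using (Fin; toℕ)
open import Data.Bool using (Bool; true; false)
open import Data.Fin.Subset using (Subset; _∈_; _∉_; _⊆_; _∩_; _-_; ⁅_⁆; ∣_∣)
  renaming (⊥ to ∅)
open import Data.Product using (Σ; ∃; ∃-syntax; _×_; _,_)
open import Relation.Binary.PropositionalEquality using (_≡_; _≢_)
open import Relation.Nullary using (¬_)

record Graph (N : ℕ) : Set where
  field
    adj    : Fin N → Fin N → Bool
    sym    : ∀ u v → adj u v ≡ adj v u
    irrefl : ∀ v → adj v v ≡ false

module _ {N : ℕ} (G : Graph N) where
  open Graph G

  Edge : Fin N → Fin N → Set
  Edge u v = adj u v ≡ true

  data Walk (S : Subset N) : Fin N → Fin N → Set where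
    here : ∀ {u} → u ∈ S → Walk S u u
    step : ∀ {u v w} → u ∈ S → Edge u v → Walk S v w → Walk S u w

  Connected : Subset N → Set
  Connected S = ∀ u v → u ∈ S → v ∈ S → Walk S u v

  IsComponent : Subset N → Set
  IsComponent C =
    (∃[ v ] v ∈ C) × Connected C ×
    (∀ D → C ⊆ D → Connected D → D ⊆ C)

  NonSeparable : Subset N → Set
  NonSeparable B = Connected B × (∀ v → v ∈ B → Connected (B - v))

  -- blocks of the induced subgraph G[W] (maximal non-separable subgraphs;
  -- such maximal subgraphs are induced, so we record their vertex sets)
  IsBlockIn : Subset N → Subset N → Set
  IsBlockIn W B =
    B ⊆ W × NonSeparable B ×
    (∀ B' → B ⊆ B' → B' ⊆ W → NonSeparable B' → B' ⊆ B)

  IsClique : Subset N → Set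
  IsClique B = ∀ u v → u ∈ B → v ∈ B → u ≢ v → Edge u v

  IsBlockGraphIn : Subset N → Set
  IsBlockGraphIn W = ∀ B → IsBlockIn W B → IsClique B

  record CliquePath (W : Subset N) : Set where
    field
      len      : ℕ
      len≥1    : 1 ≤ len
      blk      : ℕ → Subset N
      conn     : ℕ → Fin N
      isBlock  : ∀ i → i < len → IsBlockIn W (blk i)
      distinct : ∀ i j → i < len → j < len → blk i ≡ blk j → i ≡ j
      meet     : ∀ i → suc i < len → blk i ∩ blk (suc i) ≡ ⁅ conn i ⁆
      apart    : ∀ i j → suc i < j → j < len → blk i ∩ blk j ≡ ∅

  open CliquePath

  InPath : {W : Subset N} → CliquePath W → Fin N → Set
  InPath P v = ∃[ i ] (i < len P × v ∈ blk P i)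

  -- G[W] (assumed connected) is a T₁-graph
  IsT₁Conn : Subset N → Set
  IsT₁Conn W =
    IsBlockGraphIn W ×
    Σ (CliquePath W) λ P →
      (∀ (Q : CliquePath W) → len Q ≤ len P) ×
      (∀ K → IsBlockIn W K → (∀ i → i < len P → K ≢ blk P i) →
        ∃[ j ] (suc j < len P ×
          (∀ v → ((v ∈ K × InPath P v) → v ≡ conn P j)
               × (v ≡ conn P j → (v ∈ K × InPath P v)))))

  IsT₁ : Set
  IsT₁ = ∀ C → IsComponent C → IsT₁Conn C

  -- r-independent sets: every component of G[A] has at most r vertices
  -- (every set of vertices lying in the component of v has size ≤ r)
  RIndependent : ℕ → Subset N → Set
  RIndependent r A =
    ∀ v → v ∈ A → ∀ (T : Subset N) → (∀ w → w ∈ T → Walk A v w) → ∣ T ∣ ≤ r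

Complex : ℕ → Set₁
Complex N = Subset N → Set

module _ {N : ℕ} where

  IsFacet : Complex N → Subset N → Set
  IsFacet Δ F = Δ F × (∀ σ → Δ σ → F ⊆ σ → σ ≡ F)

  ShellInter : {t : ℕ} → (Fin t → Subset N) → Fin t → Complex N
  ShellInter F k σ = σ ⊆ F k × ∃[ j ] (toℕ j < toℕ k × σ ⊆ F j)

  -- shellability (not necessarily pure): an ordering F 0, …, F (t-1) of all
  -- facets such that for k > 0 the intersection is pure of dimension
  -- dim F k - 1, i.e. all its facets have ∣ F k ∣ - 1 vertices
  Shellable : Complex N → Set
  Shellable Δ =
    ∃[ t ] Σ (Fin t → Subset N) λ F →
      (∀ i → IsFacet Δ (F i)) ×
      (∀ σ → IsFacet Δ σ → ∃[ i ] F i ≡ σ) ×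
      (∀ i j → F i ≡ F j → i ≡ j) ×
      (∀ k → 0 < toℕ k →
        ∀ σ → IsFacet (ShellInter F k) σ → suc ∣ σ ∣ ≡ ∣ F k ∣)

Ind : {N : ℕ} → Graph N → ℕ → Complex N
Ind G r = RIndependent G r

{-# OPTIONS --safe #-}
-- Call the connecting vertices of the clique paths spine vertices, ordered along each path; all
-- other vertices are simplicial. Among the faces A with S ⊆ A ⊆ R, where the vertices of R ∖ S are
-- undecided, a shedding vertex is found as follows. For an undecided v let T v be the component of v
-- after deleting the undecided spine vertices beyond v, and take the first v with more than r vertices
-- in T v; if there is none, then R is a face. If A ∪ {v} is a face, some w ∈ T v is missing from it,
-- and A ∪ {w} is a face as well: either v cuts w off inside some T u with u before v, which has at
-- most r vertices, or, modulo S, every neighbour of w is joined to v, so that w can replace v.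
module Submission where

open import Defs
import Data.Bool as Bool
open import Data.Empty using (⊥; ⊥-elim)
open import Data.Fin using (Fin; zero; suc; toℕ; _≟_)
open import Data.Fin.Properties using (all?; any?; toℕ-injective)
open import Data.Fin.Subset using (Subset; inside; outside; _∈_; _∉_; _⊆_; _⊂_; _⊃_; _∪_; _─_; _-_; ⁅_⁆; ∣_∣)
  renaming (⊤ to full-set; ⊥ to ∅)
open import Data.Fin.Subset.Induction using (⊂-wellFounded; ⊃-wellFounded)
open import Data.Fin.Subset.Properties
open import Data.List using (List; []; _∷_; _++_; _ʳ++_; allFin; filter; length; lookup)
import Data.Nat.Properties as ℕ
open import Data.List.Extrema ℕ.≤-totalOrder
  using (argmin; argmax; argmin-all; argmax-all; f[argmin]≤f[xs]; f[xs]≤f[argmax])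
open import Data.List.Membership.Propositional using () renaming (_∈_ to _∈ˡ_)
open import Data.List.Membership.Propositional.Properties
  using (∈-++⁺ˡ; ∈-++⁺ʳ; ∈-++⁻; ∈-lookup; ∈-filter⁺; ∈-allFin)
open import Data.List.Relation.Unary.All using () renaming (lookup to All-lookup)
open import Data.List.Relation.Unary.All.Properties using (all-filter)
open import Data.List.Relation.Unary.Any using (here; there; index)
open import Data.List.Relation.Unary.Any.Properties using (reverseAcc⁻; reverseAcc⁺; lookup-index)
open import Data.Nat using (ℕ; zero; suc; _≤_; _<_; s≤s; z≤n; _≤?_; _<?_)
open import Data.Nat.Induction using (<-wellFounded)
open import Data.Product using (∃; ∃-syntax; _×_; _,_; proj₁; proj₂)
open import Data.Sum using (_⊎_; inj₁; inj₂)
open import Data.Vec using ([]; _∷_; here; there; tabulate)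
open import Data.Vec.Properties using (≡-dec; lookup∘tabulate; lookup⇒[]=; []=⇒lookup)
open import Induction.WellFounded using (Acc; acc)
open import Relation.Binary.Definitions using (tri<; tri≈; tri>)
open import Relation.Binary.PropositionalEquality using (_≡_; _≢_; refl; sym; trans; cong; subst)
open import Relation.Nullary using (¬_; Dec; yes; no; does)
open import Relation.Nullary.Decidable using (map′; _×-dec_; _→-dec_; ¬?; dec-true)

-- Deleting and inserting single elements of finite subsets.

suc∣p-x∣≡∣p∣ : ∀ {n} {p : Subset n} {x} → x ∈ p → suc ∣ p - x ∣ ≡ ∣ p ∣
suc∣p-x∣≡∣p∣ {p = _ ∷ p} here = cong (λ q → suc ∣ q ∣) (p─⊥≡p p)
suc∣p-x∣≡∣p∣ {p = inside ∷ p} (there x∈p) = cong suc (suc∣p-x∣≡∣p∣ x∈p)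
suc∣p-x∣≡∣p∣ {p = outside ∷ p} (there x∈p) = suc∣p-x∣≡∣p∣ x∈p

module _ {N : ℕ} where

  p-x⊆p : ∀ {p : Subset N} {x} → p - x ⊆ p
  p-x⊆p {p} {x} = p─q⊆p p ⁅ x ⁆

  -- Deleting `x` a second time changes nothing, whereas deleting an element lowers the size.
  x∉p-x : ∀ {p : Subset N} {x} → x ∉ p - x
  x∉p-x {p} {x} x∈p-x = ℕ.<-irrefl refl (ℕ.≤-<-trans (p⊆q⇒∣p∣≤∣q∣ p-x⊆p-x-x) (x∈p⇒∣p-x∣<∣p∣ x∈p-x))
    where
    p-x⊆p-x-x : p - x ⊆ p - x - x
    p-x⊆p-x-x = subst (p - x ⊆_) (sym (p─q─q≡p─q p ⁅ x ⁆)) ⊆-refl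

  ∈-∪⁅⁆⁻ : ∀ {p : Subset N} {x y} → y ∈ p ∪ ⁅ x ⁆ → y ∈ p ⊎ y ≡ x
  ∈-∪⁅⁆⁻ {p} {x} y∈ with x∈p∪q⁻ p ⁅ x ⁆ y∈
  ... | inj₁ y∈p = inj₁ y∈p
  ... | inj₂ y∈x = inj₂ (x∈⁅y⁆⇒x≡y x y∈x)

  p⊆p∪⁅x⁆ : ∀ {p : Subset N} {x} → p ⊆ p ∪ ⁅ x ⁆
  p⊆p∪⁅x⁆ {x = x} = p⊆p∪q ⁅ x ⁆

  x∈p∪⁅x⁆ : ∀ {p : Subset N} {x} → x ∈ p ∪ ⁅ x ⁆
  x∈p∪⁅x⁆ {p} {x} = q⊆p∪q p ⁅ x ⁆ (x∈⁅x⁆ x)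

  ∪⁅⁆-⊆ : ∀ {p q : Subset N} {x} → p ⊆ q → x ∈ q → p ∪ ⁅ x ⁆ ⊆ q
  ∪⁅⁆-⊆ p⊆q x∈q y∈ with ∈-∪⁅⁆⁻ y∈
  ... | inj₁ y∈p = p⊆q y∈p
  ... | inj₂ refl = x∈q

  ⊆-minus : ∀ {p q : Subset N} {x} → p ⊆ q → x ∉ p → p ⊆ q - x
  ⊆-minus p⊆q x∉p y∈p = x∈p∧x≢y⇒x∈p-y (p⊆q y∈p) λ { refl → x∉p y∈p }

  -- Shellings as lists with an exchange property.

  -- Pairwise form of the shelling condition, with `Gs` the earlier facets: the intersection of `F`
  -- and `G` lies in the ridge `F - x`, and this ridge lies in an earlier facet.
  Exchange : List (Subset N) → Subset N → Set
  Exchange Gs F = ∀ {G} → G ∈ˡ Gs → ∃[ H ] ∃[ x ] (H ∈ˡ Gs × x ∈ F × x ∉ G × F - x ⊆ H)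

  -- `Gs` holds the facets already placed, the newest first; appending therefore reverses onto it.
  data Shelled (Gs : List (Subset N)) : List (Subset N) → Set where
    []  : Shelled Gs []
    _∷_ : ∀ {F Fs} → Exchange Gs F → Shelled (F ∷ Gs) Fs → Shelled Gs (F ∷ Fs)

  Shelled-++ : ∀ {Gs Fs Fs′} → Shelled Gs Fs → Shelled (Fs ʳ++ Gs) Fs′ → Shelled Gs (Fs ++ Fs′)
  Shelled-++ []       ss′ = ss′
  Shelled-++ (e ∷ ss) ss′ = e ∷ Shelled-++ ss ss′

  -- Earlier facets come from `Gs` or from a smaller index. The induction moves the head from the
  -- second kind to the first, and translates the facet found back again.
  Shelled-lookup : ∀ {Gs Fs} → Shelled Gs Fs → ∀ k {G} →
    G ∈ˡ Gs ⊎ (∃[ j ] (toℕ j < toℕ k × lookup Fs j ≡ G)) →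
    ∃[ H ] ∃[ x ] ((H ∈ˡ Gs ⊎ (∃[ j ] (toℕ j < toℕ k × lookup Fs j ≡ H)))
                  × x ∈ lookup Fs k × x ∉ G × lookup Fs k - x ⊆ H)
  Shelled-lookup (e ∷ _) zero (inj₁ G∈) with H , x , H∈ , rest ← e G∈ = H , x , inj₁ H∈ , rest
  Shelled-lookup {Gs} {F ∷ Fs} (_ ∷ ss) (suc k) {G} G∈ = lower (Shelled-lookup ss k (raise G∈))
    where
    raise : G ∈ˡ Gs ⊎ (∃[ j ] (toℕ j < suc (toℕ k) × lookup (F ∷ Fs) j ≡ G)) →
            G ∈ˡ (F ∷ Gs) ⊎ (∃[ j ] (toℕ j < toℕ k × lookup Fs j ≡ G))
    raise (inj₁ G∈Gs) = inj₁ (there G∈Gs)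
    raise (inj₂ (zero , _ , refl)) = inj₁ (here refl)
    raise (inj₂ (suc j , s≤s j<k , eq)) = inj₂ (j , j<k , eq)
    lower : ∃[ H ] ∃[ x ] ((H ∈ˡ (F ∷ Gs) ⊎ (∃[ j ] (toℕ j < toℕ k × lookup Fs j ≡ H)))
                  × x ∈ lookup Fs k × x ∉ G × lookup Fs k - x ⊆ H) →
            ∃[ H ] ∃[ x ] ((H ∈ˡ Gs ⊎ (∃[ j ] (toℕ j < suc (toℕ k) × lookup (F ∷ Fs) j ≡ H)))
                  × x ∈ lookup Fs k × x ∉ G × lookup Fs k - x ⊆ H)
    lower (H , x , inj₁ (here refl) , rest) = H , x , inj₂ (zero , s≤s z≤n , refl) , rest
    lower (H , x , inj₁ (there H∈) , rest) = H , x , inj₁ H∈ , rest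
    lower (H , x , inj₂ (j , j<k , eq) , rest) = H , x , inj₂ (suc j , s≤s j<k , eq) , rest

  shelled⇒shellable : ∀ {Δ : Complex N} Fs →
    (∀ {F} → F ∈ˡ Fs → IsFacet Δ F) → (∀ {F} → IsFacet Δ F → F ∈ˡ Fs) →
    Shelled [] Fs → Shellable Δ
  shelled⇒shellable {Δ} Fs facets complete ss =
    length Fs , lookup Fs , (λ i → facets (∈-lookup i)) ,
    (λ σ σ-facet → index (complete σ-facet) , sym (lookup-index (complete σ-facet))) ,
    injective , pure
    where
    exchange : ∀ k j → toℕ j < toℕ k → ∃[ i ] ∃[ x ]
      (toℕ i < toℕ k × x ∈ lookup Fs k × x ∉ lookup Fs j × lookup Fs k - x ⊆ lookup Fs i)
    exchange k j j<k with Shelled-lookup ss k (inj₂ (j , j<k , refl))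
    ... | _ , x , inj₂ (i , i<k , refl) , rest = i , x , i<k , rest
    -- Exchange already forces distinctness: its `x` lies in the later facet but not in the earlier
    -- one.
    later-≢ : ∀ k j → toℕ j < toℕ k → lookup Fs j ≢ lookup Fs k
    later-≢ k j j<k eq with _ , x , _ , x∈ , x∉ , _ ← exchange k j j<k = x∉ (subst (x ∈_) (sym eq) x∈)
    injective : ∀ i j → lookup Fs i ≡ lookup Fs j → i ≡ j
    injective i j eq with ℕ.<-cmp (toℕ i) (toℕ j)
    ... | tri< i<j _ _ = ⊥-elim (later-≢ j i i<j eq)
    ... | tri≈ _ i≡j _ = toℕ-injective i≡j
    ... | tri> _ _ j<i = ⊥-elim (later-≢ i j j<i (sym eq))
    pure : ∀ k → 0 < toℕ k → ∀ σ → IsFacet (ShellInter (lookup Fs) k) σ → suc ∣ σ ∣ ≡ ∣ lookup Fs k ∣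
    pure k _ σ ((σ⊆Fk , j , j<k , σ⊆Fj) , maximal)
      with i , x , i<k , x∈ , x∉ , ⊆Fi ← exchange k j j<k
      -- The ridge `lookup Fs k - x` belongs to the intersection and contains `σ`, so maximality
      -- makes them equal.
      with refl ← maximal (lookup Fs k - x) (p-x⊆p , i , i<k , ⊆Fi) (⊆-minus σ⊆Fk (λ x∈σ → x∉ (σ⊆Fj x∈σ)))
      = suc∣p-x∣≡∣p∣ x∈

  -- Shedding trees and the shellings they produce.

  -- Decision tree for the faces A with S ⊆ A ⊆ R; each node splits on a shedding vertex,
  -- so that the facets of the deletion remain facets.
  data Shedding (Δ : Complex N) (R S : Subset N) : Set where
    void  : ¬ Δ S → Shedding Δ R S
    full  : S ⊆ R → Δ R → Shedding Δ R S
    split : ∀ v → v ∈ R → v ∉ S →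
      (∀ A → S ⊆ A → A ⊆ R → v ∉ A → Δ (A ∪ ⁅ v ⁆) →
        ∃[ w ] (w ∈ R × w ≢ v × w ∉ A × Δ (A ∪ ⁅ w ⁆))) →
      Shedding Δ (R - v) S → Shedding Δ R (S ∪ ⁅ v ⁆) → Shedding Δ R S

  module _ {Δ : Complex N} (Δ-down : ∀ {A B} → A ⊆ B → Δ B → Δ A) where

    facets : ∀ {R S} → Shedding Δ R S → List (Subset N)
    facets (void _) = []
    facets {R} (full _ _) = R ∷ []
    facets (split _ _ _ _ del lnk) = facets del ++ facets lnk

    facets-sound : ∀ {R S} (t : Shedding Δ R S) {F} → F ∈ˡ facets t →
      S ⊆ F × F ⊆ R × Δ F × (∀ {A} → F ⊆ A → A ⊆ R → Δ A → A ⊆ F)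
    facets-sound (full S⊆R ΔR) (here refl) = S⊆R , ⊆-refl , ΔR , λ _ A⊆R _ → A⊆R
    facets-sound {R} {S} (split v v∈R v∉S shed del lnk) {F} F∈ with ∈-++⁻ (facets del) F∈
    ... | inj₁ F∈del with S⊆F , F⊆ , ΔF , maximal ← facets-sound del F∈del =
      S⊆F , F⊆R , ΔF , maximal′
      where
      F⊆R : F ⊆ R
      F⊆R x∈ = p-x⊆p (F⊆ x∈)
      v∉F : v ∉ F
      v∉F v∈F = x∉p-x (F⊆ v∈F)
      maximal′ : ∀ {A} → F ⊆ A → A ⊆ R → Δ A → A ⊆ F
      maximal′ {A} F⊆A A⊆R ΔA with v ∈? A
      ... | no v∉A = maximal F⊆A (⊆-minus A⊆R v∉A) ΔA
      -- A larger face through `v` would make `F ∪ ⁅ v ⁆` a face; shedding then supplies a `w` that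
      -- enlarges `F` within the deletion, where `F` is maximal.
      ... | yes v∈A
        with w , w∈R , w≢v , w∉F , Δw ← shed F S⊆F F⊆R v∉F (Δ-down (∪⁅⁆-⊆ F⊆A v∈A) ΔA) =
        ⊥-elim (w∉F (maximal p⊆p∪⁅x⁆ (∪⁅⁆-⊆ F⊆ (x∈p∧x≢y⇒x∈p-y w∈R w≢v)) Δw x∈p∪⁅x⁆))
    ... | inj₂ F∈lnk with S⊆F , F⊆R , ΔF , maximal ← facets-sound lnk F∈lnk =
      (λ x∈S → S⊆F (p⊆p∪⁅x⁆ x∈S)) , F⊆R , ΔF , maximal

    facets-cover : ∀ {R S} (t : Shedding Δ R S) {A} → S ⊆ A → A ⊆ R → Δ A →
      ∃[ F ] (F ∈ˡ facets t × A ⊆ F)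
    facets-cover (void ¬ΔS) S⊆A _ ΔA = ⊥-elim (¬ΔS (Δ-down S⊆A ΔA))
    facets-cover (full _ _) _ A⊆R _ = _ , here refl , A⊆R
    facets-cover (split v _ _ _ del lnk) {A} S⊆A A⊆R ΔA with v ∈? A
    ... | yes v∈A with F , F∈ , A⊆F ← facets-cover lnk (∪⁅⁆-⊆ S⊆A v∈A) A⊆R ΔA =
      F , ∈-++⁺ʳ (facets del) F∈ , A⊆F
    ... | no v∉A with F , F∈ , A⊆F ← facets-cover del S⊆A (⊆-minus A⊆R v∉A) ΔA =
      F , ∈-++⁺ˡ F∈ , A⊆F

    -- Facets of the deletion precede those of the link. If `F` comes from the link, then `F - v` is
    -- a face of the deletion and extends to one of its facets `H`; thus `v` and `H` serve the
    -- exchange against every facet of the deletion.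
    facets-shelled : ∀ {R S} (t : Shedding Δ R S) {Gs} →
      (∀ {F} → F ∈ˡ facets t → Exchange Gs F) → Shelled Gs (facets t)
    facets-shelled (void _) _ = []
    facets-shelled (full _ _) e = e (here refl) ∷ []
    facets-shelled {R} {S} (split v v∈R v∉S _ del lnk) {Gs} e =
      Shelled-++ (facets-shelled del (λ F∈ → e (∈-++⁺ˡ F∈))) (facets-shelled lnk e′)
      where
      e′ : ∀ {F} → F ∈ˡ facets lnk → Exchange (facets del ʳ++ Gs) F
      e′ {F} F∈ {G} G∈ with reverseAcc⁻ Gs (facets del) G∈
      ... | inj₁ G∈Gs with H , x , H∈ , rest ← e (∈-++⁺ʳ (facets del) F∈) G∈Gs =
        H , x , reverseAcc⁺ Gs (facets del) (inj₁ H∈) , rest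
      ... | inj₂ G∈del
        with S∪v⊆F , F⊆R , ΔF , _ ← facets-sound lnk F∈
        with _ , G⊆ , _ ← facets-sound del G∈del
        with H , H∈ , F-v⊆H ← facets-cover del
               (⊆-minus (λ x∈S → S∪v⊆F (p⊆p∪⁅x⁆ x∈S)) v∉S)
               (λ x∈F-v → ⊆-minus {p = F - v} (λ y∈ → F⊆R (p-x⊆p y∈)) x∉p-x x∈F-v)
               (Δ-down p-x⊆p ΔF) =
        H , v , reverseAcc⁺ Gs (facets del) (inj₂ H∈) , S∪v⊆F x∈p∪⁅x⁆ , (λ v∈G → x∉p-x (G⊆ v∈G)) , F-v⊆H

    shedding⇒shellable : Shedding Δ full-set ∅ → Shellable Δ
    shedding⇒shellable t = shelled⇒shellable (facets t) sound complete (facets-shelled t (λ _ ()))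
      where
      sound : ∀ {F} → F ∈ˡ facets t → IsFacet Δ F
      sound F∈ with _ , _ , ΔF , maximal ← facets-sound t F∈ =
        ΔF , λ A ΔA F⊆A → ⊆-antisym (maximal F⊆A ⊆⊤ ΔA) F⊆A
      complete : ∀ {F} → IsFacet Δ F → F ∈ˡ facets t
      complete (ΔF , maximal) with H , H∈ , F⊆H ← facets-cover t ⊥⊆ ⊆⊤ ΔF
        with refl ← maximal H (proj₁ (proj₂ (proj₂ (facets-sound t H∈)))) F⊆H = H∈

-- Decidable subsets and extremal elements.

module _ {n : ℕ} {P : Fin n → Set} (P? : ∀ x → Dec (P x)) where

  abstract
    comprehension : Subset n
    comprehension = tabulate (λ x → does (P? x))

    ∈-comprehension⁺ : ∀ {x} → P x → x ∈ comprehension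
    ∈-comprehension⁺ {x} px = lookup⇒[]= x comprehension
      (trans (lookup∘tabulate (λ y → does (P? y)) x) (dec-true (P? x) px))

    ∈-comprehension⁻ : ∀ {x} → x ∈ comprehension → P x
    ∈-comprehension⁻ {x} x∈ with P? x | trans (sym (lookup∘tabulate (λ y → does (P? y)) x)) ([]=⇒lookup x∈)
    ... | yes px | _ = px
    ... | no _ | ()

  module _ (f : Fin n → ℕ) where

    least-such : ∃ P → ∃[ x ] (P x × (∀ {y} → P y → f x ≤ f y))
    least-such (x₀ , px₀) = argmin f x₀ xs , argmin-all f px₀ (all-filter P? (allFin n)) ,
      λ {y} py → All-lookup (f[argmin]≤f[xs] x₀ xs) (∈-filter⁺ P? (∈-allFin y) py)
      where xs = filter P? (allFin n)

    greatest-such : ∃ P → ∃[ x ] (P x × (∀ {y} → P y → f y ≤ f x))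
    greatest-such (x₀ , px₀) = argmax f x₀ xs , argmax-all f px₀ (all-filter P? (allFin n)) ,
      λ {y} py → All-lookup (f[xs]≤f[argmax] x₀ xs) (∈-filter⁺ P? (∈-allFin y) py)
      where xs = filter P? (allFin n)

-- Walks and components.

module _ {N : ℕ} (G : Graph N) where

  edge-sym : ∀ {u v} → Edge G u v → Edge G v u
  edge-sym {u} {v} e = trans (Graph.sym G v u) e

  edge-≢ : ∀ {u v} → Edge G u v → u ≢ v
  edge-≢ {u} e refl with () ← trans (sym e) (Graph.irrefl G u)

  edge? : ∀ u v → Dec (Edge G u v)
  edge? u v = Graph.adj G u v Bool.≟ Bool.true

  source∈ : ∀ {T u v} → Walk G T u v → u ∈ T
  source∈ (here u∈) = u∈
  source∈ (step u∈ _ _) = u∈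

  target∈ : ∀ {T u v} → Walk G T u v → v ∈ T
  target∈ (here u∈) = u∈
  target∈ (step _ _ w) = target∈ w

  infixr 5 _∙_
  _∙_ : ∀ {T u v w} → Walk G T u v → Walk G T v w → Walk G T u w
  here _ ∙ q = q
  step u∈ e p ∙ q = step u∈ e (p ∙ q)

  edge-walk : ∀ {T u v} → u ∈ T → v ∈ T → Edge G u v → Walk G T u v
  edge-walk u∈ v∈ e = step u∈ e (here v∈)

  reverse : ∀ {T u v} → Walk G T u v → Walk G T v u
  reverse (here u∈) = here u∈
  reverse (step u∈ e p) = reverse p ∙ edge-walk (source∈ p) u∈ (edge-sym e)

  -- Asking only about vertices reached from `u` lets one lemma serve both for enlarging `T` and for
  -- shrinking it to a component.
  walk-restrict : ∀ {T T′ u v} → (∀ {x} → Walk G T u x → x ∈ T′) → Walk G T u v → Walk G T′ u v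
  walk-restrict reach⊆ (here u∈) = here (reach⊆ (here u∈))
  walk-restrict reach⊆ (step u∈ e p) =
    step (reach⊆ (here u∈)) e (walk-restrict (λ q → reach⊆ (step u∈ e q)) p)

  walk-mono : ∀ {T T′ u v} → T ⊆ T′ → Walk G T u v → Walk G T′ u v
  walk-mono T⊆T′ = walk-restrict (λ q → T⊆T′ (target∈ q))

  -- Either the walk avoids u, or its part after the last visit of u does.
  last-exit : ∀ {T a b} u → u ≢ b → Walk G T a b →
    Walk G (T - u) a b ⊎ (∃[ v ] (Edge G u v × Walk G (T - u) v b))
  last-exit u u≢b (here b∈) = inj₁ (here (x∈p∧x≢y⇒x∈p-y b∈ (λ b≡u → u≢b (sym b≡u))))
  last-exit {a = a} u u≢b (step a∈ e p) with last-exit u u≢b p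
  ... | inj₂ exit = inj₂ exit
  ... | inj₁ q with u ≟ a
  ...   | yes refl = inj₂ (_ , e , q)
  ...   | no u≢a = inj₁ (step (x∈p∧x≢y⇒x∈p-y a∈ (λ a≡u → u≢a (sym a≡u))) e q)

  first-exit : ∀ {T u b} → u ≢ b → Walk G T u b → ∃[ v ] (Edge G u v × Walk G (T - u) v b)
  first-exit {u = u} u≢b p with last-exit u u≢b p
  ... | inj₁ q = ⊥-elim (x∉p-x (source∈ q))
  ... | inj₂ exit = exit

  abstract
    -- After its last visit to `u`, a walk to another vertex stays in `T - u`, so the search
    -- recurses on strictly smaller sets.
    walk? : ∀ T u v → Dec (Walk G T u v)
    walk? T = go T (⊂-wellFounded T)
      where
      go : ∀ T → Acc _⊂_ T → ∀ u v → Dec (Walk G T u v)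
      go T (acc rec) u v with u ∈? T
      ... | no u∉T = no λ p → u∉T (source∈ p)
      ... | yes u∈T with u ≟ v
      ...   | yes refl = yes (here u∈T)
      ...   | no u≢v = map′ (λ (w , e , p) → step u∈T e (walk-mono p-x⊆p p)) (first-exit u≢v)
                         (any? λ w → edge? u w ×-dec go (T - u) (rec (x∈p⇒p-x⊂p u∈T)) w v)

  component : Subset N → Fin N → Subset N
  component T u = comprehension (walk? T u)

  ∈-component⁺ : ∀ {T u v} → Walk G T u v → v ∈ component T u
  ∈-component⁺ {T} {u} = ∈-comprehension⁺ (walk? T u)

  ∈-component⁻ : ∀ {T u v} → v ∈ component T u → Walk G T u v
  ∈-component⁻ {T} {u} = ∈-comprehension⁻ (walk? T u)

  walk-component : ∀ {T u v} → Walk G T u v → Walk G (component T u) u v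
  walk-component = walk-restrict ∈-component⁺

  component⊆ : ∀ {T u} → component T u ⊆ T
  component⊆ v∈ = target∈ (∈-component⁻ v∈)

  -- The complex of r-independent sets.

  module _ {r : ℕ} where

    Ind-component : ∀ {A v} → Ind G r A → v ∈ A → ∣ component A v ∣ ≤ r
    Ind-component ind v∈A = ind _ v∈A _ (λ _ → ∈-component⁻)

    -- The component of `v` is the largest set of vertices reachable from `v`, so it is the only one
    -- to be counted.
    component-Ind : ∀ {A} → (∀ v → v ∈ A → ∣ component A v ∣ ≤ r) → Ind G r A
    component-Ind small v v∈A T reach = ℕ.≤-trans (p⊆q⇒∣p∣≤∣q∣ (λ x∈ → ∈-component⁺ (reach _ x∈))) (small v v∈A)

    Ind? : ∀ A → Dec (Ind G r A)
    Ind? A = map′ component-Ind (λ ind v → Ind-component ind)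
      (all? λ v → (v ∈? A) →-dec (∣ component A v ∣ ≤? r))

    Ind-down : ∀ {A B} → A ⊆ B → Ind G r B → Ind G r A
    Ind-down A⊆B ind v v∈A T reach = ind v (A⊆B v∈A) T (λ w w∈T → walk-mono A⊆B (reach w w∈T))

    -- A component of the enlarged set either contains `w` or lies within `A`.
    Ind-∪⁅⁆ : ∀ {A w} → Ind G r A → ∣ component (A ∪ ⁅ w ⁆) w ∣ ≤ r → Ind G r (A ∪ ⁅ w ⁆)
    Ind-∪⁅⁆ {A} {w} ind small = component-Ind go
      where
      go : ∀ v → v ∈ A ∪ ⁅ w ⁆ → ∣ component (A ∪ ⁅ w ⁆) v ∣ ≤ r
      go v v∈ with walk? (A ∪ ⁅ w ⁆) v w
      ... | yes p = ℕ.≤-trans (p⊆q⇒∣p∣≤∣q∣ (λ x∈ → ∈-component⁺ (reverse p ∙ ∈-component⁻ x∈))) small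
      ... | no ¬p = ℕ.≤-trans (p⊆q⇒∣p∣≤∣q∣ (λ x∈ → ∈-component⁺ (walk-restrict inA (∈-component⁻ x∈))))
                     (Ind-component ind (inA (here v∈)))
        where
        inA : ∀ {x} → Walk G (A ∪ ⁅ w ⁆) v x → x ∈ A
        inA q with ∈-∪⁅⁆⁻ (target∈ q)
        ... | inj₁ x∈A = x∈A
        ... | inj₂ refl = ⊥-elim (¬p q)

  -- Spine ranks and the choice of a shedding vertex.

  -- Rank 0 marks the vertices whose neighbourhood is a clique; the others are ordered by rank
  -- along each component, separating lower from higher ranks.
  record SpineRank (ρ : Fin N → ℕ) : Set where
    field
      simplicial : ∀ {w a b} → ρ w ≡ 0 → Edge G w a → Edge G w b → a ≢ b → Edge G a b
      injective  : ∀ {T a b} → 0 < ρ a → ρ a ≡ ρ b → Walk G T a b → a ≡ b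
      separates  : ∀ {T T′ a b c} → 0 < ρ a → ρ a < ρ b → ρ b < ρ c →
                   Walk G T′ a b → Walk G T a c → b ∈ T

  module _ {ρ : Fin N → ℕ} (spine : SpineRank ρ) (r : ℕ) where
    open SpineRank spine

    -- Vertices of rank 0 can be skipped, since the neighbours before and after them on the walk
    -- coincide or are adjacent. In `bypass-edge`, `a` is the last vertex kept and `t` the next
    -- candidate.
    bypass : ∀ {T Q a b} → (∀ {t} → t ∈ T → t ∈ Q ⊎ ρ t ≡ 0) →
             a ∈ Q → b ∈ Q → Walk G T a b → Walk G Q a b
    bypass-edge : ∀ {T Q a b t} → (∀ {t} → t ∈ T → t ∈ Q ⊎ ρ t ≡ 0) →
             a ∈ Q → b ∈ Q → Edge G a t → Walk G T t b → Walk G Q a b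
    bypass h a∈ b∈ (here _) = here b∈
    bypass h a∈ b∈ (step _ e p) = bypass-edge h a∈ b∈ e p
    bypass-edge h a∈ b∈ e (here _) = edge-walk a∈ b∈ e
    bypass-edge {a = a} h a∈ b∈ e (step {v = t′} t∈ e′ p) with h t∈
    ... | inj₁ t∈Q = step a∈ e (bypass-edge h t∈Q b∈ e′ p)
    ... | inj₂ ρt≡0 with a ≟ t′
    ...   | yes refl = bypass h a∈ b∈ p
    ...   | no a≢t′ = bypass-edge h a∈ b∈ (simplicial ρt≡0 (edge-sym e) e′ a≢t′) p

    module _ {R S : Subset N} (S⊆R : S ⊆ R) (S-face : Ind G r S) where

      -- Vertices of `S` lie in every face considered, so they are never deleted, whatever their
      -- rank.
      Later : Fin N → Fin N → Set
      Later v u = u ∉ S × ρ v < ρ u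

      later? : ∀ v u → Dec (Later v u)
      later? v u = ¬? (u ∈? S) ×-dec (ρ v <? ρ u)

      upTo? : ∀ v u → Dec (u ∈ R × ¬ Later v u)
      upTo? v u = (u ∈? R) ×-dec ¬? (later? v u)

      -- For `v` in `R`, the component of `v` in this set is the T v of the outline.
      upTo : Fin N → Subset N
      upTo v = comprehension (upTo? v)

      upTo⁺ : ∀ {v u} → u ∈ R → ¬ Later v u → u ∈ upTo v
      upTo⁺ {v} u∈R ¬later = ∈-comprehension⁺ (upTo? v) (u∈R , ¬later)

      upTo⁻ : ∀ {v u} → u ∈ upTo v → u ∈ R × ¬ Later v u
      upTo⁻ {v} = ∈-comprehension⁻ (upTo? v)

      Big : Fin N → Set
      Big v = v ∈ R × v ∉ S × r < ∣ component (upTo v) v ∣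

      big? : ∀ v → Dec (Big v)
      big? v = (v ∈? R) ×-dec ¬? (v ∈? S) ×-dec (r <? ∣ component (upTo v) v ∣)

      -- In a component of `R` with undecided vertices, take such a `v` of greatest rank: nothing
      -- there is later than `v`, so the component lies in T v. A component without undecided
      -- vertices lies in the face `S`.
      no-big⇒face : (∀ v → ¬ Big v) → Ind G r R
      no-big⇒face none = component-Ind go
        where
        go : ∀ t → t ∈ R → ∣ component R t ∣ ≤ r
        go t t∈R with any? (λ u → ¬? (u ∈? S) ×-dec walk? R t u)
        ... | yes some
          with v , (v∉S , p) , max ← greatest-such (λ u → ¬? (u ∈? S) ×-dec walk? R t u) ρ some
          = ℕ.≮⇒≥ λ r< → none v (target∈ p , v∉S , ℕ.<-≤-trans r< (p⊆q⇒∣p∣≤∣q∣ λ x∈ →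
              ∈-component⁺ (walk-restrict
                (λ q → upTo⁺ (target∈ q) λ (u∉S , ρv<ρu) → ℕ.<⇒≱ ρv<ρu (max (u∉S , p ∙ q)))
                (reverse p ∙ ∈-component⁻ x∈))))
        ... | no none-free = ℕ.≤-trans
            (p⊆q⇒∣p∣≤∣q∣ (λ x∈ → ∈-component⁺ (walk-restrict inS (∈-component⁻ x∈))))
            (Ind-component S-face (inS (here t∈R)))
          where
          inS : ∀ {x} → Walk G R t x → x ∈ S
          inS {x} q with x ∈? S
          ... | yes x∈S = x∈S
          ... | no x∉S = ⊥-elim (none-free (x , x∉S , q))

      module _ {v : Fin N} (big : Big v) (least : ∀ {u} → Big u → ρ v ≤ ρ u)
               {A : Subset N} (S⊆A : S ⊆ A) (A⊆R : A ⊆ R) (v∉A : v ∉ A) (face : Ind G r (A ∪ ⁅ v ⁆)) where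

        -- Otherwise T v, connected and with more than `r` vertices, would lie inside the face
        -- `A ∪ ⁅ v ⁆`.
        missing : ∃[ w ] (w ∈ component (upTo v) v × w ∉ A ∪ ⁅ v ⁆)
        missing with any? (λ w → (w ∈? component (upTo v) v) ×-dec ¬? (w ∈? (A ∪ ⁅ v ⁆)))
        ... | yes found = found
        ... | no none = ⊥-elim (ℕ.<⇒≱ (proj₂ (proj₂ big))
                (face v x∈p∪⁅x⁆ _ λ w w∈ → walk-restrict inA (∈-component⁻ w∈)))
          where
          inA : ∀ {x} → Walk G (upTo v) v x → x ∈ A ∪ ⁅ v ⁆
          inA {x} p with x ∈? (A ∪ ⁅ v ⁆)
          ... | yes x∈ = x∈
          ... | no x∉ = ⊥-elim (none (x , ∈-component⁺ p , x∉))

        module _ {w : Fin N} (v⇝w : Walk G (upTo v) v w) (w∉A : w ∉ A) (w≢v : w ≢ v) where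

          -- The piece of T v that contains `w` once `v` is deleted.
          E : Subset N
          E = component (upTo v - v) w

          A∪w⊆R-v : A ∪ ⁅ w ⁆ ⊆ R - v
          A∪w⊆R-v = ∪⁅⁆-⊆ (⊆-minus A⊆R v∉A) (x∈p∧x≢y⇒x∈p-y (proj₁ (upTo⁻ (target∈ v⇝w))) w≢v)

          A-face : Ind G r A
          A-face = Ind-down p⊆p∪⁅x⁆ face

          exit : ∃[ z ] (Edge G v z × Walk G (upTo v - v) z w)
          exit = first-exit (λ v≡w → w≢v (sym v≡w)) v⇝w

          w∈E : w ∈ E
          w∈E = ∈-component⁺ (here (target∈ (proj₂ (proj₂ exit))))

          -- The part of w is cut off by v from everything later than v, so it stays below its
          -- largest undecided spine vertex u, and minimality of v bounds it.
          face-left : (∃[ u ] (u ∈ E × u ∉ S × 0 < ρ u)) → Ind G r (A ∪ ⁅ w ⁆)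
          face-left some
            with u , (u∈E , u∉S , 0<ρu) , max ← greatest-such
                   (λ u → (u ∈? E) ×-dec ¬? (u ∈? S) ×-dec (0 <? ρ u)) ρ some
            = Ind-∪⁅⁆ A-face (ℕ.≤-trans (p⊆q⇒∣p∣≤∣q∣ reach⊆) small)
            where
            w⇝u : Walk G (upTo v - v) w u
            w⇝u = ∈-component⁻ u∈E

            v⇝u : Walk G (upTo v) v u
            v⇝u = v⇝w ∙ walk-mono p-x⊆p w⇝u

            ρu<ρv : ρ u < ρ v
            -- An undecided vertex of `upTo v` has rank at most that of `v`; equal ranks would give
            -- `u ≡ v`, but `E` avoids `v`.
            ρu<ρv = ℕ.≤∧≢⇒< (ℕ.≮⇒≥ λ ρv<ρu → proj₂ (upTo⁻ (target∈ v⇝u)) (u∉S , ρv<ρu))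
              λ ρu≡ρv → x∉p-x (subst (_∈ upTo v - v) (injective 0<ρu ρu≡ρv (reverse v⇝u)) (target∈ w⇝u))

            small : ∣ component (upTo u) u ∣ ≤ r
            small = ℕ.≮⇒≥ λ r< → ℕ.<⇒≱ ρu<ρv (least (proj₁ (upTo⁻ (target∈ v⇝u)) , u∉S , r<))

            reach⊆E : ∀ {x} → Walk G (A ∪ ⁅ w ⁆) w x → x ∈ E
            reach⊆E p = ∈-component⁺ (walk-restrict not-later p)
              where
              not-later : ∀ {y} → Walk G (A ∪ ⁅ w ⁆) w y → y ∈ upTo v - v
              -- An undecided `y` later than `v` would be joined to `u` through `w` inside `R - v`,
              -- although `v` separates their ranks.
              not-later {y} q = x∈p∧x≢y⇒x∈p-y (upTo⁺ (p-x⊆p y∈) (λ (y∉S , ρv<ρy) →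
                  x∉p-x (separates 0<ρu ρu<ρv ρv<ρy (reverse v⇝u)
                    (walk-mono upTo-v⊆ (reverse w⇝u) ∙ walk-mono A∪w⊆R-v q))))
                  λ { refl → x∉p-x y∈ }
                where
                y∈ : y ∈ R - v
                y∈ = A∪w⊆R-v (target∈ q)
                upTo-v⊆ : upTo v - v ⊆ R - v
                upTo-v⊆ = ⊆-minus (λ x∈ → proj₁ (upTo⁻ (p-x⊆p x∈))) x∉p-x

            E⊆ : E ⊆ component (upTo u) u
            E⊆ x∈E = ∈-component⁺ (walk-restrict below (reverse w⇝u ∙ ∈-component⁻ x∈E))
              where
              below : ∀ {y} → Walk G (upTo v - v) u y → y ∈ upTo u
              -- An undecided vertex of `E` later than `u` would contradict the choice of `u` as the
              -- one of greatest rank.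
              below q = upTo⁺ (proj₁ (upTo⁻ (p-x⊆p (target∈ q)))) λ (y∉S , ρu<ρy) →
                ℕ.<⇒≱ ρu<ρy (max (∈-component⁺ (w⇝u ∙ q) , y∉S , ℕ.<-trans 0<ρu ρu<ρy))

            reach⊆ : component (A ∪ ⁅ w ⁆) w ⊆ component (upTo u) u
            reach⊆ x∈ = E⊆ (reach⊆E (∈-component⁻ x∈))

          -- Here v dominates w: neighbours of w are joined to v by bypassing simplicial vertices.
          face-dominated : (∀ {u} → u ∈ E → u ∈ S ⊎ ρ u ≡ 0) → Ind G r (A ∪ ⁅ w ⁆)
          face-dominated E⊆ = Ind-∪⁅⁆ A-face (ℕ.≤-trans size (Ind-component face x∈p∪⁅x⁆))
            where
            K K′ : Subset N
            K  = component (A ∪ ⁅ v ⁆) v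
            K′ = component (A ∪ ⁅ w ⁆) w

            minus-w⊆A : (A ∪ ⁅ w ⁆) - w ⊆ A
            minus-w⊆A y∈ with ∈-∪⁅⁆⁻ (p-x⊆p y∈)
            ... | inj₁ y∈A = y∈A
            ... | inj₂ refl = ⊥-elim (x∉p-x y∈)

            to-neighbour : ∀ {z} → z ∈ A → Edge G w z → Walk G (A ∪ ⁅ v ⁆) v z
            to-neighbour {z} z∈A w~z with y , v~y , y⇝w ← exit =
              -- The walk goes from `v` to its neighbour `y`, through `E` to `w`, and on to `z`. Its
              -- vertices in `E` are in `S`, hence in `A`, or can be bypassed.
              bypass-edge {T = E ∪ ⁅ z ⁆} ok x∈p∪⁅x⁆ (p⊆p∪⁅x⁆ z∈A) v~y
                (walk-mono p⊆p∪⁅x⁆ (reverse (walk-component (reverse y⇝w)))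
                  ∙ edge-walk (p⊆p∪⁅x⁆ w∈E) x∈p∪⁅x⁆ w~z)
              where
              ok : ∀ {t} → t ∈ E ∪ ⁅ z ⁆ → t ∈ A ∪ ⁅ v ⁆ ⊎ ρ t ≡ 0
              ok t∈ with ∈-∪⁅⁆⁻ t∈
              ... | inj₂ refl = inj₁ (p⊆p∪⁅x⁆ z∈A)
              ... | inj₁ t∈E with E⊆ t∈E
              ...   | inj₁ t∈S = inj₁ (p⊆p∪⁅x⁆ (S⊆A t∈S))
              ...   | inj₂ ρt≡0 = inj₂ ρt≡0

            -- Once it has left `w` for good, a walk stays in `A`, and its first vertex there is a
            -- neighbour of `w`, hence joined to `v`.
            K′-w⊆K-v : K′ - w ⊆ K - v
            K′-w⊆K-v {x} x∈ with z , w~z , q ← first-exit (λ { refl → x∉p-x x∈ }) (∈-component⁻ (p-x⊆p x∈))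
              = x∈p∧x≢y⇒x∈p-y
                  (∈-component⁺ (to-neighbour (minus-w⊆A (source∈ q)) w~z
                                  ∙ walk-mono (λ y∈ → p⊆p∪⁅x⁆ (minus-w⊆A y∈)) q))
                  λ { refl → v∉A (minus-w⊆A (target∈ q)) }

            size : ∣ K′ ∣ ≤ ∣ K ∣
            size = subst (∣ K′ ∣ ≤_) (suc∣p-x∣≡∣p∣ {p = K} {v} (∈-component⁺ (here x∈p∪⁅x⁆)))
              (subst (_≤ suc ∣ K - v ∣) (suc∣p-x∣≡∣p∣ {p = K′} {w} (∈-component⁺ (here x∈p∪⁅x⁆)))
                (s≤s (p⊆q⇒∣p∣≤∣q∣ K′-w⊆K-v)))

          face-∪⁅w⁆ : Ind G r (A ∪ ⁅ w ⁆)
          face-∪⁅w⁆ with any? (λ u → (u ∈? E) ×-dec ¬? (u ∈? S) ×-dec (0 <? ρ u))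
          ... | yes some = face-left some
          ... | no none = face-dominated decided
            where
            decided : ∀ {u} → u ∈ E → u ∈ S ⊎ ρ u ≡ 0
            decided {u} u∈E with u ∈? S
            ... | yes u∈S = inj₁ u∈S
            ... | no u∉S = inj₂ (ℕ.n≤0⇒n≡0 (ℕ.≮⇒≥ λ 0<ρu → none (u , u∈E , u∉S , 0<ρu)))

        least-big-sheds : ∃[ w ] (w ∈ R × w ≢ v × w ∉ A × Ind G r (A ∪ ⁅ w ⁆))
        least-big-sheds with w , w∈ , w∉ ← missing =
          w , proj₁ (upTo⁻ (component⊆ w∈)) , w≢v , w∉A , face-∪⁅w⁆ (∈-component⁻ w∈) w∉A w≢v
          where
          w∉A : w ∉ A
          w∉A w∈A = w∉ (p⊆p∪⁅x⁆ w∈A)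
          w≢v : w ≢ v
          w≢v refl = w∉ x∈p∪⁅x⁆

    -- A big vertex of least rank is the shedding vertex. Either branch decides it, which shrinks
    -- `R ─ S`.
    spine-shedding : ∀ {R S} → S ⊆ R → Acc _<_ ∣ R ─ S ∣ → Shedding (Ind G r) R S
    spine-shedding {R} {S} S⊆R (acc rec) with Ind? {r} S
    ... | no ¬face = void ¬face
    ... | yes face with any? (big? S⊆R face)
    ...   | no none = full S⊆R (no-big⇒face S⊆R face λ v big → none (v , big))
    ...   | yes some with v , big , least ← least-such (big? S⊆R face) ρ some =
      split v v∈R v∉S (λ A → least-big-sheds S⊆R face big least)
        (spine-shedding (⊆-minus S⊆R v∉S) (rec (p⊂q⇒∣p∣<∣q∣
          (del⊆ , v , v∈R─S , λ v∈ → x∉p-x (p─q⊆p _ S v∈)))))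
        (spine-shedding (∪⁅⁆-⊆ S⊆R v∈R) (rec (p⊂q⇒∣p∣<∣q∣
          (lnk⊆ , v , v∈R─S , λ v∈ → x∉p-x (subst (v ∈_) (sym (p─q─r≡p─q∪r R S ⁅ v ⁆)) v∈)))))
      where
      v∈R : v ∈ R
      v∈R = proj₁ big
      v∉S : v ∉ S
      v∉S = proj₁ (proj₂ big)
      v∈R─S : v ∈ R ─ S
      v∈R─S = x∈p∧x∉q⇒x∈p─q v∈R v∉S
      del⊆ : (R - v) ─ S ⊆ R ─ S
      del⊆ x∈ = p─q⊆p (R ─ S) ⁅ v ⁆ (subst (_ ∈_) (p─q─r≡p─r─q R ⁅ v ⁆ S) x∈)
      lnk⊆ : R ─ (S ∪ ⁅ v ⁆) ⊆ R ─ S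
      lnk⊆ x∈ = p─q⊆p (R ─ S) ⁅ v ⁆ (subst (_ ∈_) (sym (p─q─r≡p─q∪r R S ⁅ v ⁆)) x∈)

    spine-shellable : Shellable (Ind G r)
    spine-shellable = shedding⇒shellable Ind-down (spine-shedding ⊥⊆ (<-wellFounded _))

  -- Cliques and blocks.

  clique-connected : ∀ {B} → IsClique G B → Connected G B
  clique-connected clique u v u∈ v∈ with u ≟ v
  ... | yes refl = here u∈
  ... | no u≢v = edge-walk u∈ v∈ (clique u v u∈ v∈ u≢v)

  clique-nonSeparable : ∀ {B} → IsClique G B → NonSeparable G B
  clique-nonSeparable clique = clique-connected clique ,
    λ v _ → clique-connected λ x y x∈ y∈ → clique x y (p-x⊆p x∈) (p-x⊆p y∈)

  clique-∪⁅⁆ : ∀ {B u} → IsClique G B → (∀ {x} → x ∈ B → x ≢ u → Edge G x u) → IsClique G (B ∪ ⁅ u ⁆)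
  clique-∪⁅⁆ clique adj x y x∈ y∈ x≢y with ∈-∪⁅⁆⁻ x∈ | ∈-∪⁅⁆⁻ y∈
  ... | inj₁ x∈B  | inj₁ y∈B  = clique x y x∈B y∈B x≢y
  ... | inj₁ x∈B  | inj₂ refl = adj x∈B x≢y
  ... | inj₂ refl | inj₁ y∈B  = edge-sym (adj y∈B (λ y≡x → x≢y (sym y≡x)))
  ... | inj₂ refl | inj₂ refl = ⊥-elim (x≢y refl)

  ⁅⁆-clique : ∀ u → IsClique G ⁅ u ⁆
  ⁅⁆-clique u x y x∈ y∈ x≢y = ⊥-elim (x≢y (trans (x∈⁅y⁆⇒x≡y u x∈) (sym (x∈⁅y⁆⇒x≡y u y∈))))

  connected? : ∀ B → Dec (Connected G B)
  connected? B = all? λ u → all? λ v → (u ∈? B) →-dec (v ∈? B) →-dec walk? B u v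

  nonSeparable? : ∀ B → Dec (NonSeparable G B)
  nonSeparable? B = connected? B ×-dec all? λ v → (v ∈? B) →-dec connected? (B - v)

  -- Enlarge `B` among the non-separable subsets of `W` until no strictly larger one exists.
  nonSeparable⊆block : ∀ {W} B → B ⊆ W → NonSeparable G B → ∃[ K ] (B ⊆ K × IsBlockIn G W K)
  nonSeparable⊆block {W} B = go B (⊃-wellFounded B)
    where
    go : ∀ B → Acc _⊃_ B → B ⊆ W → NonSeparable G B → ∃[ K ] (B ⊆ K × IsBlockIn G W K)
    go B (acc rec) B⊆W nonSep
      with anySubset? (λ B′ → (B ⊂? B′) ×-dec (B′ ⊆? W) ×-dec nonSeparable? B′)
    ... | yes (B′ , B⊂B′ , B′⊆W , nonSep′) with K , B′⊆K , block ← go B′ (rec B⊂B′) B′⊆W nonSep′ =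
      K , (λ x∈ → B′⊆K (proj₁ B⊂B′ x∈)) , block
    ... | no none = B , ⊆-refl , B⊆W , nonSep , largest
      where
      largest : ∀ B′ → B ⊆ B′ → B′ ⊆ W → NonSeparable G B′ → B′ ⊆ B
      largest B′ B⊆B′ B′⊆W nonSep′ {x} x∈B′ with x ∈? B
      ... | yes x∈B = x∈B
      ... | no x∉B = ⊥-elim (none (B′ , (B⊆B′ , x , x∈B′ , x∉B) , B′⊆W , nonSep′))

  -- Simple paths and cycles.

  -- Repetitions are excluded by deleting each vertex from the ambient set as the path moves on.
  data Path (T : Subset N) : Fin N → Fin N → Set where
    stop : ∀ {u} → u ∈ T → Path T u u
    cons : ∀ {u v w} → u ∈ T → Edge G u v → Path (T - u) v w → Path T u w

  walk⇒path : ∀ {T u v} → Walk G T u v → Path T u v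
  walk⇒path {T} = go (⊂-wellFounded T)
    where
    go : ∀ {T u v} → Acc _⊂_ T → Walk G T u v → Path T u v
    go {u = u} {v} (acc rec) p with u ≟ v
    ... | yes refl = stop (source∈ p)
    ... | no u≢v with w , e , q ← first-exit u≢v p =
      cons (source∈ p) e (go (rec (x∈p⇒p-x⊂p (source∈ p))) q)

  vertices : ∀ {T u v} → Path T u v → Subset N
  vertices (stop {u} _) = ⁅ u ⁆
  vertices (cons {u} _ _ p) = vertices p ∪ ⁅ u ⁆

  vertices⊆ : ∀ {T u v} (p : Path T u v) → vertices p ⊆ T
  vertices⊆ (stop {u} u∈) x∈ with refl ← x∈⁅y⁆⇒x≡y u x∈ = u∈
  vertices⊆ (cons u∈ _ p) = ∪⁅⁆-⊆ (λ x∈ → p-x⊆p (vertices⊆ p x∈)) u∈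

  path-start∈ : ∀ {T u v} (p : Path T u v) → u ∈ vertices p
  path-start∈ (stop _) = x∈⁅x⁆ _
  path-start∈ (cons _ _ _) = x∈p∪⁅x⁆

  path-end∈ : ∀ {T u v} (p : Path T u v) → v ∈ vertices p
  path-end∈ (stop _) = x∈⁅x⁆ _
  path-end∈ (cons _ _ p) = p⊆p∪⁅x⁆ (path-end∈ p)

  path-to-end : ∀ {T u v} (p : Path T u v) {x} → x ∈ vertices p → Walk G (vertices p) x v
  path-to-end (stop {u} _) x∈ with refl ← x∈⁅y⁆⇒x≡y u x∈ = here x∈
  path-to-end (cons _ e p) x∈ with ∈-∪⁅⁆⁻ x∈
  ... | inj₁ x∈p = walk-mono p⊆p∪⁅x⁆ (path-to-end p x∈p)
  ... | inj₂ refl = step x∈ e (walk-mono p⊆p∪⁅x⁆ (path-to-end p (path-start∈ p)))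

  -- Deleting `y` leaves at most two pieces of the path, each containing one of its ends.
  path-to-ends : ∀ {T u v} (p : Path T u v) {x y} → x ∈ vertices p → x ≢ y →
    Walk G (vertices p - y) x u ⊎ Walk G (vertices p - y) x v
  path-to-ends (stop {u} _) x∈ x≢y with refl ← x∈⁅y⁆⇒x≡y u x∈ = inj₁ (here (x∈p∧x≢y⇒x∈p-y x∈ x≢y))
  path-to-ends (cons {u} _ e p) {x} {y} x∈ x≢y with ∈-∪⁅⁆⁻ x∈
  ... | inj₂ refl = inj₁ (here (x∈p∧x≢y⇒x∈p-y x∈ x≢y))
  ... | inj₁ x∈p with u ≟ y
  ...   | yes refl = inj₂ (walk-mono (⊆-minus p⊆p∪⁅x⁆ (λ y∈ → x∉p-x (vertices⊆ p y∈))) (path-to-end p x∈p))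
  ...   | no u≢y with path-to-ends p x∈p x≢y
  ...     | inj₂ q = inj₂ (walk-mono minus⊆ q)
    where
    minus⊆ : vertices p - y ⊆ (vertices p ∪ ⁅ u ⁆) - y
    minus⊆ = ⊆-minus (λ z∈ → p⊆p∪⁅x⁆ (p-x⊆p z∈)) x∉p-x
  ...     | inj₁ q = inj₁ (walk-mono minus⊆ q
      ∙ edge-walk (minus⊆ (target∈ q)) (x∈p∧x≢y⇒x∈p-y x∈p∪⁅x⁆ u≢y) (edge-sym e))
    where
    minus⊆ : vertices p - y ⊆ (vertices p ∪ ⁅ u ⁆) - y
    minus⊆ = ⊆-minus (λ z∈ → p⊆p∪⁅x⁆ (p-x⊆p z∈)) x∉p-x

  to-hub⇒connected : ∀ {B} c → (∀ {x} → x ∈ B → Walk G B x c) → Connected G B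
  to-hub⇒connected c to u v u∈ v∈ = to u∈ ∙ reverse (to v∈)

  -- Deleting `c` leaves the path. Deleting another vertex leaves pieces that each keep an end of
  -- the path, and both ends are adjacent to `c`.
  cycle-nonSeparable : ∀ {T a b c} → Edge G c a → Edge G c b → (p : Path T a b) → c ∉ T →
    NonSeparable G (vertices p ∪ ⁅ c ⁆)
  cycle-nonSeparable {T} {a} {b} {c} c~a c~b p c∉T = to-hub⇒connected c to-c , minus
    where
    to-c : ∀ {x} → x ∈ vertices p ∪ ⁅ c ⁆ → Walk G (vertices p ∪ ⁅ c ⁆) x c
    to-c x∈ with ∈-∪⁅⁆⁻ x∈
    ... | inj₂ refl = here x∈
    ... | inj₁ x∈p = walk-mono p⊆p∪⁅x⁆ (path-to-end p x∈p)
      ∙ edge-walk (p⊆p∪⁅x⁆ (path-end∈ p)) x∈p∪⁅x⁆ (edge-sym c~b)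
    minus : ∀ y → y ∈ vertices p ∪ ⁅ c ⁆ → Connected G ((vertices p ∪ ⁅ c ⁆) - y)
    minus y _ with c ≟ y
    ... | yes refl = to-hub⇒connected b to-b
      where
      p⊆ : vertices p ⊆ (vertices p ∪ ⁅ c ⁆) - c
      p⊆ = ⊆-minus p⊆p∪⁅x⁆ (λ c∈ → c∉T (vertices⊆ p c∈))
      to-b : ∀ {x} → x ∈ (vertices p ∪ ⁅ c ⁆) - c → Walk G ((vertices p ∪ ⁅ c ⁆) - c) x b
      to-b x∈ with ∈-∪⁅⁆⁻ (p-x⊆p x∈)
      ... | inj₁ x∈p = walk-mono p⊆ (path-to-end p x∈p)
      ... | inj₂ refl = ⊥-elim (x∉p-x x∈)
    ... | no c≢y = to-hub⇒connected c to-c′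
      where
      p⊆ : vertices p - y ⊆ (vertices p ∪ ⁅ c ⁆) - y
      p⊆ = ⊆-minus (λ z∈ → p⊆p∪⁅x⁆ (p-x⊆p z∈)) x∉p-x
      via : ∀ {x z} → Edge G c z → Walk G (vertices p - y) x z → Walk G ((vertices p ∪ ⁅ c ⁆) - y) x c
      via c~z q = walk-mono p⊆ q
        ∙ edge-walk (p⊆ (target∈ q)) (x∈p∧x≢y⇒x∈p-y x∈p∪⁅x⁆ c≢y) (edge-sym c~z)
      to-c′ : ∀ {x} → x ∈ (vertices p ∪ ⁅ c ⁆) - y → Walk G ((vertices p ∪ ⁅ c ⁆) - y) x c
      to-c′ x∈ with ∈-∪⁅⁆⁻ (p-x⊆p x∈)
      ... | inj₂ refl = here x∈
      ... | inj₁ x∈p with path-to-ends p x∈p (λ { refl → x∉p-x x∈ })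
      ...   | inj₁ q = via c~a q
      ...   | inj₂ q = via c~b q

  -- Adjacency forced by cliques as blocks.

  module _ {W : Subset N} (blocks : IsBlockGraphIn G W) where

    -- A path from `a` to `b` avoiding `c` closes up through `c`; the resulting cycle lies in a
    -- block, which is a clique.
    joined-neighbours-adjacent : ∀ {a b c} → c ∈ W → Edge G c a → Edge G c b →
      Walk G (W - c) a b → a ≢ b → Edge G a b
    joined-neighbours-adjacent {a} {b} {c} c∈W c~a c~b q a≢b
      with p ← walk⇒path q
      with K , ⊆K , block ← nonSeparable⊆block (vertices p ∪ ⁅ c ⁆)
                              (∪⁅⁆-⊆ (λ x∈ → p-x⊆p (vertices⊆ p x∈)) c∈W)
                              (cycle-nonSeparable c~a c~b p x∉p-x) =
      blocks K block a b (⊆K (p⊆p∪⁅x⁆ (path-start∈ p))) (⊆K (p⊆p∪⁅x⁆ (path-end∈ p))) a≢b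

    edge-block : ∀ {a w} → a ∈ W → w ∈ W → Edge G w a → ∃[ K ] (w ∈ K × a ∈ K × IsBlockIn G W K)
    edge-block {a} {w} a∈W w∈W w~a
      with K , ⊆K , block ← nonSeparable⊆block (⁅ a ⁆ ∪ ⁅ w ⁆)
             (∪⁅⁆-⊆ (λ x∈ → subst (_∈ W) (sym (x∈⁅y⁆⇒x≡y a x∈)) a∈W) w∈W)
             (clique-nonSeparable (clique-∪⁅⁆ (⁅⁆-clique a) λ x∈ _ →
               subst (λ x → Edge G x w) (sym (x∈⁅y⁆⇒x≡y a x∈)) (edge-sym w~a))) =
      K , ⊆K x∈p∪⁅x⁆ , ⊆K (p⊆p∪⁅x⁆ (x∈⁅x⁆ a)) , block

    -- Every other vertex of `B` is a neighbour of `c` joined to `u` through `a` without using `c`,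
    -- hence adjacent to `u`. So `B ∪ ⁅ u ⁆` is a clique, and `B` is maximal.
    block-absorbs : ∀ {B a c u} → IsBlockIn G W B → c ∈ B → a ∈ B → u ∈ W → Edge G c u →
      Walk G (W - c) a u → u ∈ B
    block-absorbs {B} {a} {c} {u} block@(B⊆W , _ , largest) c∈B a∈B u∈W c~u a⇝u =
      largest (B ∪ ⁅ u ⁆) p⊆p∪⁅x⁆ (∪⁅⁆-⊆ B⊆W u∈W)
        (clique-nonSeparable (clique-∪⁅⁆ clique adj)) x∈p∪⁅x⁆
      where
      clique : IsClique G B
      clique = blocks B block
      adj : ∀ {x} → x ∈ B → x ≢ u → Edge G x u
      adj {x} x∈B x≢u with x ≟ c
      ... | yes refl = c~u
      ... | no x≢c = joined-neighbours-adjacent (B⊆W c∈B) (clique c x c∈B x∈B (λ c≡x → x≢c (sym c≡x))) c~u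
                       (x⇝a ∙ a⇝u) x≢u
        where
        x∈W-c : x ∈ W - c
        x∈W-c = x∈p∧x≢y⇒x∈p-y (B⊆W x∈B) x≢c
        x⇝a : Walk G (W - c) x a
        x⇝a with x ≟ a
        ... | yes refl = here x∈W-c
        ... | no x≢a = edge-walk x∈W-c (source∈ a⇝u) (clique x a x∈B a∈B x≢a)

  -- The clique path of one component.

  module Spine {W : Subset N} (closed : ∀ {x y} → x ∈ W → Edge G x y → y ∈ W) (t₁ : IsT₁Conn G W) where

    private
      blocks : IsBlockGraphIn G W
      blocks = proj₁ t₁

      P : CliquePath G W
      P = proj₁ (proj₂ t₁)

    open CliquePath P

    walk⊆W : ∀ {T u v} → u ∈ W → Walk G T u v → v ∈ W
    walk⊆W u∈W (here _) = u∈W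
    walk⊆W u∈W (step _ e p) = walk⊆W (closed u∈W e) p

    conn∈₀ : ∀ i → suc i < len → conn i ∈ blk i
    conn∈₀ i i< = p∩q⊆p _ _ (subst (conn i ∈_) (sym (meet i i<)) (x∈⁅x⁆ (conn i)))

    conn∈₁ : ∀ i → suc i < len → conn i ∈ blk (suc i)
    conn∈₁ i i< = p∩q⊆q _ _ (subst (conn i ∈_) (sym (meet i i<)) (x∈⁅x⁆ (conn i)))

    conn∈W : ∀ i → suc i < len → conn i ∈ W
    conn∈W i i< = proj₁ (isBlock (suc i) i<) (conn∈₁ i i<)

    blk-apart : ∀ i j {x} → suc i < j → j < len → x ∈ blk i → x ∈ blk j → ⊥
    blk-apart i j i<j j< x∈i x∈j = ∉⊥ (subst (_ ∈_) (apart i j i<j j<) (x∈p∩q⁺ (x∈i , x∈j)))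

    shared⇒conn : ∀ {i j x} → i < j → j < len → x ∈ blk i → x ∈ blk j → suc i ≡ j × x ≡ conn i
    shared⇒conn {i} {j} {x} i<j j< x∈i x∈j with ℕ.m≤n⇒m<n∨m≡n i<j
    ... | inj₁ i+1<j = ⊥-elim (blk-apart i j i+1<j j< x∈i x∈j)
    ... | inj₂ refl = refl , x∈⁅y⁆⇒x≡y (conn i) (subst (x ∈_) (meet i j<) (x∈p∩q⁺ (x∈i , x∈j)))

    conn-distinct : ∀ i j → i < j → suc j < len → conn i ≢ conn j
    conn-distinct i j i<j j< eq = blk-apart i (suc j) (s≤s i<j) j<
      (conn∈₀ i (ℕ.<-trans (s≤s i<j) j<)) (subst (_∈ blk (suc j)) (sym eq) (conn∈₁ j j<))

    conn-edge : ∀ i → suc (suc i) < len → Edge G (conn i) (conn (suc i))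
    conn-edge i i< = blocks (blk (suc i)) (isBlock (suc i) i<′) _ _ (conn∈₁ i i<′) (conn∈₀ (suc i) i<)
      (conn-distinct i (suc i) ℕ.≤-refl i<)
      where
      i<′ : suc i < len
      i<′ = ℕ.<-trans ℕ.≤-refl i<

    conn-walk : ∀ {T} i k → i ≤ k → suc k < len → (∀ m → i ≤ m → m ≤ k → conn m ∈ T) →
      Walk G T (conn i) (conn k)
    conn-walk i k i≤k k< ∈T with ℕ.m≤n⇒m<n∨m≡n i≤k
    ... | inj₂ refl = here (∈T i ℕ.≤-refl ℕ.≤-refl)
    conn-walk i (suc k) i≤k k< ∈T | inj₁ (s≤s i≤k′) =
      conn-walk i k i≤k′ (ℕ.<-trans ℕ.≤-refl k<) (λ m i≤m m≤k → ∈T m i≤m (ℕ.m≤n⇒m≤1+n m≤k))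
      ∙ edge-walk (∈T k i≤k′ (ℕ.n≤1+n k)) (∈T (suc k) i≤k ℕ.≤-refl) (conn-edge k k<)

    conn-walk-avoiding : ∀ {w} i k → suc i < len → suc k < len → (∀ m → suc m < len → conn m ≢ w) →
      Walk G (W - w) (conn i) (conn k)
    conn-walk-avoiding i k i< k< avoid with ℕ.≤-total i k
    ... | inj₁ i≤k = conn-walk i k i≤k k< λ m _ m≤k → on m (ℕ.≤-<-trans (s≤s m≤k) k<)
      where on = λ m m< → x∈p∧x≢y⇒x∈p-y (conn∈W m m<) (avoid m m<)
    ... | inj₂ k≤i = reverse (conn-walk k i k≤i i< λ m _ m≤i → on m (ℕ.≤-<-trans (s≤s m≤i) i<))
      where on = λ m m< → x∈p∧x≢y⇒x∈p-y (conn∈W m m<) (avoid m m<)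

    -- The block of the edge is not on the path, so it contains some `conn j`, which differs from
    -- `w`; the block stays connected without `w`.
    off-path⇒spine : ∀ {w x} → w ∈ W → ¬ InPath G P w → Edge G w x →
      ∃[ j ] (suc j < len × Walk G (W - w) x (conn j))
    off-path⇒spine {w} {x} w∈W off-path w~x
      with K , w∈K , x∈K , block@(K⊆W , (_ , minus) , _) ← edge-block blocks (closed w∈W w~x) w∈W w~x
      with j , j< , only-j ← proj₂ (proj₂ (proj₂ t₁)) K block
             (λ k k< eq → off-path (k , k< , subst (w ∈_) eq w∈K))
      with conn∈K , conn∈P ← proj₂ (only-j (conn j)) refl =
      j , j< , walk-mono (⊆-minus (λ y∈ → K⊆W (p-x⊆p y∈)) x∉p-x)
        (minus w w∈K x (conn j)
          (x∈p∧x≢y⇒x∈p-y x∈K (λ x≡w → edge-≢ w~x (sym x≡w)))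
          (x∈p∧x≢y⇒x∈p-y conn∈K (λ { refl → off-path conn∈P })))

    -- If `w` is on the path, a single block contains it and all its neighbours. If not, both
    -- neighbours reach connecting vertices without using `w`, and these are joined along the path,
    -- so the neighbours are adjacent.
    non-conn-simplicial : ∀ {w a b} → w ∈ W → (∀ j → suc j < len → conn j ≢ w) →
      Edge G w a → Edge G w b → a ≢ b → Edge G a b
    non-conn-simplicial {w} {a} {b} w∈W not-conn w~a w~b a≢b with ℕ.anyUpTo? (λ i → w ∈? blk i) len
    ... | yes (i , i< , w∈i) = blocks (blk i) (isBlock i i<) a b (neighbour∈ w~a) (neighbour∈ w~b) a≢b
      where
      only : ∀ K → IsBlockIn G W K → w ∈ K → K ≡ blk i
      only K block w∈K with ℕ.anyUpTo? (λ k → ≡-dec Bool._≟_ K (blk k)) len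
      ... | no off with j , j< , only-j ← proj₂ (proj₂ (proj₂ t₁)) K block (λ k k< eq → off (k , k< , eq)) =
        ⊥-elim (not-conn j j< (sym (proj₁ (only-j w) (w∈K , i , i< , w∈i))))
      ... | yes (k , k< , refl) with ℕ.<-cmp i k
      ...   | tri≈ _ refl _ = refl
      ...   | tri< i<k _ _ with refl , w≡ ← shared⇒conn i<k k< w∈i w∈K = ⊥-elim (not-conn i k< (sym w≡))
      ...   | tri> _ _ k<i with refl , w≡ ← shared⇒conn k<i i< w∈K w∈i = ⊥-elim (not-conn k i< (sym w≡))
      neighbour∈ : ∀ {x} → Edge G w x → x ∈ blk i
      neighbour∈ w~x with K , w∈K , x∈K , block ← edge-block blocks (closed w∈W w~x) w∈W w~x =
        subst (_ ∈_) (only K block w∈K) x∈K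
    ... | no off-path
      with j , j< , a⇝ ← off-path⇒spine w∈W off-path w~a
      with k , k< , b⇝ ← off-path⇒spine w∈W off-path w~b =
      joined-neighbours-adjacent blocks w∈W w~a w~b
        (a⇝ ∙ conn-walk-avoiding j k j< k< not-conn ∙ reverse b⇝) a≢b

    -- Otherwise the connecting vertices just before and after `conn j` would be joined around it,
    -- and `blk j` would absorb the latter, which also lies two blocks further on.
    conn-separates : ∀ i j k → i < j → j < k → suc k < len → ¬ Walk G (W - conn j) (conn i) (conn k)
    conn-separates i (suc j) k (s≤s i≤j) j<k k< i⇝k =
      blk-apart (suc j) (suc (suc (suc j))) ℕ.≤-refl j+3<
        (block-absorbs blocks (isBlock (suc j) j+1<) (conn∈₀ (suc j) j+2<) (conn∈₁ j j+1<)
          (conn∈W (suc (suc j)) j+3<) (conn-edge (suc j) j+3<)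
          (reverse (conn-walk i j i≤j j+1< below) ∙ i⇝k ∙ reverse (conn-walk (suc (suc j)) k j<k k< above)))
        (conn∈₁ (suc (suc j)) j+3<)
      where
      j+3< : suc (suc (suc j)) < len
      j+3< = ℕ.≤-<-trans (s≤s j<k) k<
      j+2< : suc (suc j) < len
      j+2< = ℕ.<-trans ℕ.≤-refl j+3<
      j+1< : suc j < len
      j+1< = ℕ.<-trans ℕ.≤-refl j+2<
      below : ∀ m → i ≤ m → m ≤ j → conn m ∈ W - conn (suc j)
      below m _ m≤j = x∈p∧x≢y⇒x∈p-y (conn∈W m (ℕ.≤-<-trans (s≤s m≤j) j+1<)) (conn-distinct m (suc j) (s≤s m≤j) j+2<)
      above : ∀ m → suc (suc j) ≤ m → m ≤ k → conn m ∈ W - conn (suc j)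
      above m j<m m≤k = x∈p∧x≢y⇒x∈p-y (conn∈W m m<) λ eq → conn-distinct (suc j) m j<m m< (sym eq)
        where
        m< : suc m < len
        m< = ℕ.≤-<-trans (s≤s m≤k) k<

    -- Ranking the connecting vertices.

    connIndex? : ∀ v → Dec (∃[ i ] (i < len × suc i < len × conn i ≡ v))
    connIndex? v = ℕ.anyUpTo? (λ i → (suc i <? len) ×-dec (conn i ≟ v)) len

    -- The index is shifted by one to leave 0 for vertices that are not connecting.
    rank : Fin N → ℕ
    rank v with connIndex? v
    ... | yes (i , _) = suc i
    ... | no _ = 0

    rank≡0 : ∀ {v} → rank v ≡ 0 → ∀ j → suc j < len → conn j ≢ v
    rank≡0 {v} eq j j< conn≡ with connIndex? v
    rank≡0 () j j< conn≡ | yes _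
    ... | no none = none (j , ℕ.<-trans ℕ.≤-refl j< , j< , conn≡)

    rank>0 : ∀ {v} → 0 < rank v → ∃[ i ] (rank v ≡ suc i × suc i < len × conn i ≡ v)
    rank>0 {v} pos with connIndex? v
    ... | yes (i , _ , i< , conn≡) = i , refl , i< , conn≡
    rank>0 () | no _

    rank-injective : ∀ {a b} → 0 < rank a → rank a ≡ rank b → a ≡ b
    rank-injective pos eq
      with i , ρa , _ , refl ← rank>0 pos
      with k , ρb , _ , refl ← rank>0 (subst (0 <_) eq pos) =
      cong conn (ℕ.suc-injective (trans (sym ρa) (trans eq ρb)))

    rank-separates : ∀ {T a b c} → 0 < rank a → rank a < rank b → rank b < rank c →
      Walk G T a c → b ∈ T
    rank-separates {T} {a} {b} {c} 0<a a<b b<c p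
      with i , ρa , i< , refl ← rank>0 0<a
      with j , ρb , j< , refl ← rank>0 (ℕ.<-trans 0<a a<b)
      with k , ρc , k< , refl ← rank>0 (ℕ.<-trans 0<a (ℕ.<-trans a<b b<c))
      with conn j ∈? T
    ... | yes b∈T = b∈T
    ... | no b∉T rewrite ρa | ρb | ρc = ⊥-elim (conn-separates i j k (ℕ.≤-pred a<b) (ℕ.≤-pred b<c) k<
            (walk-restrict (λ q → x∈p∧x≢y⇒x∈p-y (walk⊆W (conn∈W i i<) q) λ { refl → b∉T (target∈ q) }) p))

  -- From single components to the whole graph.

  component-isComponent : ∀ v → IsComponent G (component full-set v)
  component-isComponent v = (v , ∈-component⁺ (here ∈⊤)) ,
    (λ x y x∈ y∈ → reverse (to x∈) ∙ to y∈) ,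
    (λ D ⊆D connected x∈D → ∈-component⁺ (walk-mono ⊆⊤ (connected v _ (⊆D (∈-component⁺ (here ∈⊤))) x∈D)))
    where
    to : ∀ {x} → x ∈ component full-set v → Walk G (component full-set v) v x
    to x∈ = walk-component (∈-component⁻ x∈)

  -- A representative of each component, so that ranks computed from different vertices of a
  -- component refer to the same clique path.
  least-reachable : ∀ v → ∃[ u ] (Walk G full-set v u × (∀ {x} → Walk G full-set v x → toℕ u ≤ toℕ x))
  least-reachable v = least-such (walk? full-set v) toℕ (v , here ∈⊤)

  representative : Fin N → Fin N
  representative v = proj₁ (least-reachable v)

  to-representative : ∀ v → Walk G full-set v (representative v)
  to-representative v = proj₁ (proj₂ (least-reachable v))

  representative-≤ : ∀ {u v} → Walk G full-set u v → toℕ (representative u) ≤ toℕ (representative v)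
  representative-≤ {u} {v} p = proj₂ (proj₂ (least-reachable u)) (p ∙ to-representative v)

  representative-cong : ∀ {u v} → Walk G full-set u v → representative u ≡ representative v
  representative-cong p = toℕ-injective (ℕ.≤-antisym (representative-≤ p) (representative-≤ (reverse p)))

  module _ (t₁ : IsT₁ G) where

    component-closed : ∀ {v x y} → x ∈ component full-set v → Edge G x y → y ∈ component full-set v
    component-closed x∈ e = ∈-component⁺ (∈-component⁻ x∈ ∙ edge-walk ∈⊤ ∈⊤ e)

    module ComponentSpine (v : Fin N) = Spine (component-closed {v}) (t₁ _ (component-isComponent v))

    spineRank : Fin N → ℕ
    spineRank v = ComponentSpine.rank (representative v) v

    -- Vertices joined by a walk share a representative, so their ranks can be rewritten as ranks
    -- along one clique path.
    isSpineRank : SpineRank spineRank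
    isSpineRank = record
      { simplicial = λ {w} ρ≡0 → ComponentSpine.non-conn-simplicial (representative w)
          (∈-component⁺ (reverse (to-representative w))) (ComponentSpine.rank≡0 (representative w) ρ≡0)
      ; injective = λ {_} {a} {b} 0<a eq p → ComponentSpine.rank-injective (representative a) 0<a
          (trans eq (cong (λ u → ComponentSpine.rank u b) (same (reverse p))))
      ; separates = λ {_} {_} {a} {b} {c} 0<a a<b b<c p q →
          let b≡ = cong (λ u → ComponentSpine.rank u b) (same (reverse p))
              c≡ = cong (λ u → ComponentSpine.rank u c) (same (reverse q))
          in ComponentSpine.rank-separates (representative a) 0<a (subst (ComponentSpine.rank _ a <_) b≡ a<b)
               (subst (_< ComponentSpine.rank _ c) b≡ (subst (spineRank b <_) c≡ b<c)) q
      }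
      where
      same : ∀ {T u v} → Walk G T u v → representative u ≡ representative v
      same p = representative-cong (walk-mono ⊆⊤ p)

theorem4p16 : ∀ {N : ℕ} (G : Graph N) → IsT₁ G → ∀ (r : ℕ) → 5 ≤ r → Shellable (Ind G r)
theorem4p16 G t₁ r _ = spine-shellable G (isSpineRank G t₁) r
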